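{- Every integral flow $f$ on an oriented signed graph $(\Sigma,\omega)$ can be lifted to an integral flow $\tilde f$ on the oriented double covering graph $(\widetilde\Sigma,\widetilde\omega)$, i.e. there is an integral flow $\tilde f$ on $(\widetilde\Sigma,\widetilde\omega)$ with $\pi(\tilde f)=f$.
   Context: Signed graph: finite graph (loops, multiple edges allowed) with edge signs $\sigma(e)\in\{\pm1\}$; each edge has two ends $(u,e),(v,e)$ (a loop has two distinct ends). An orientation assigns $\omega(v,e)\in\{\pm1\}$ to edge ends with $\sigma(e)=-\omega(u,e)\omega(v,e)$. Boundary $\partial g(v)=\sum_{(v,e)}\omega(v,e)g(e)$ over the edge ends at $v$; integral flow: $f:E\to\mathbb Z$ with $\partial f\equiv0$. Double covering graph $\widetilde\Sigma$: vertices $v^\alpha$ ($v\in V$, $\alpha\in\{+,-\}$); each edge $e$ with ends $(u,e),(v,e)$ lifts to two edges $\tilde e,\tilde e^*$ joining $u^\alpha$ and $v^{\alpha\sigma(e)}$ for $\alpha=\pm$, the end at $u^\alpha$ lying over $(u,e)$ and the end at $v^{\alpha\sigma(e)}$ over $(v,e)$. Lifted orientation: $\widetilde\omega(v^\alpha,\tilde e)=\alpha\,\omega(v,e)$ for the end of $\tilde e$ at $v^\alpha$ over $(v,e)$; flows on $(\widetilde\Sigma,\widetilde\omega)$ are defined by the same boundary formula. Projection: $\pi(\tilde f)(e)=\tilde f(\tilde e)+\tilde f(\tilde e^*)$. -}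

module Defs where

open import Data.Nat using (ℕ)
open import Data.Fin using (Fin; zero; suc)
import Data.Fin as Fin
open import Data.Integer using (ℤ; +_; _+_; _*_; -_)
open import Data.Sign as Sign using (Sign)
import Data.Sign.Properties as SignP
open import Data.List using (foldr; tabulate)
open import Data.Product using (_×_; _,_)
import Data.Product.Properties as ProdP
open import Relation.Binary.PropositionalEquality using (_≡_)
open import Relation.Binary.Definitions using (DecidableEquality)
open import Relation.Nullary using (yes; no)

-- Signs ±1 are elements of Data.Sign.Sign (+ / -); as integers:
signℤ : Sign → ℤ
signℤ Sign.+ = + 1
signℤ Sign.- = - (+ 1)

-- The two ends of an edge are indexed by Fin 2
-- (zero = the end (u,e), suc zero = the end (v,e)).
End : Set
End = Fin 2

-- finite sum over Fin k
∑ : ∀ {k} → (Fin k → ℤ) → ℤ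
∑ {k} f = foldr _+_ (+ 0) (tabulate f)

-- A signed graph with vertex set Fin n and edge set Fin m; loops
-- (endpoint e zero ≡ endpoint e (suc zero)) and multiple edges are allowed.
record SignedGraph (n m : ℕ) : Set where
  field
    endpoint : Fin m → End → Fin n
    sign     : Fin m → Sign
open SignedGraph public

-- An orientation assigns ±1 to every edge end, subject to σ(e) = - ω(u,e) ω(v,e).
record Orientation {n m : ℕ} (Σ : SignedGraph n m) : Set where
  field
    ω      : Fin m → End → Sign
    compat : ∀ e → sign Σ e ≡ Sign.opposite (ω e zero Sign.* ω e (suc zero))
open Orientation public

-- contribution of an edge end lying at vertex y to the boundary at x:
-- ω(y,e) g(e) if y = x, otherwise 0
endTerm : ∀ {V : Set} → DecidableEquality V → V → V → Sign → ℤ → ℤ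
endTerm _≟_ x y s a with y ≟ x
... | yes _ = signℤ s * a
... | no  _ = + 0

-- boundary ∂g(x) = Σ_{edge ends (x,e)} ω(x,e) g(e)
∂ : ∀ {n m} {Σ : SignedGraph n m} → Orientation Σ → (Fin m → ℤ) → Fin n → ℤ
∂ {Σ = Σ} O g x =
  ∑ λ e → ∑ λ (i : End) → endTerm Fin._≟_ x (endpoint Σ e i) (ω O e i) (g e)

IsIntegralFlow : ∀ {n m} {Σ : SignedGraph n m} → Orientation Σ → (Fin m → ℤ) → Set
IsIntegralFlow {n} O f = ∀ (x : Fin n) → ∂ O f x ≡ + 0

------------------------------------------------------------------------
-- Double covering graph.
-- Vertices v^α : Fin n × Sign.  Edges: Fin m × Sign, where (e , +) is ẽ
-- and (e , -) is ẽ*.  The lift (e , α) has its end 0 (over (u,e)) at u^α and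
-- its end 1 (over (v,e)) at v^{α σ(e)}.

CVertex : ℕ → Set
CVertex n = Fin n × Sign

CEdge : ℕ → Set
CEdge m = Fin m × Sign

_≟V_ : ∀ {n} → DecidableEquality (CVertex n)
_≟V_ = ProdP.≡-dec Fin._≟_ SignP._≟_

-- sheet (α or α σ(e)) of the lifted end i of (e , α)
liftSheet : ∀ {n m} → SignedGraph n m → CEdge m → End → Sign
liftSheet Σ (e , α) zero = α
liftSheet Σ (e , α) (suc zero) = α Sign.* sign Σ e

-- endpoint of the lifted end i of (e , α)
liftEndpoint : ∀ {n m} → SignedGraph n m → CEdge m → End → CVertex n
liftEndpoint Σ (e , α) i = (endpoint Σ e i , liftSheet Σ (e , α) i)

-- lifted orientation: ω̃(v^β, ẽ) = β ω(v,e) for the end of ẽ at v^β over (v,e)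
liftω : ∀ {n m} (Σ : SignedGraph n m) → Orientation Σ → CEdge m → End → Sign
liftω Σ O (e , α) i = liftSheet Σ (e , α) i Sign.* ω O e i

-- boundary on the double cover (same formula: sum over all edge ends at x̃)
∂̃ : ∀ {n m} (Σ : SignedGraph n m) → Orientation Σ → (CEdge m → ℤ) → CVertex n → ℤ
∂̃ Σ O g x =
  ∑ λ e → ∑ λ (a : Fin 2) → ∑ λ (i : End) →
    let ẽ = (e , sheet a) in
    endTerm _≟V_ x (liftEndpoint Σ ẽ i) (liftω Σ O ẽ i) (g ẽ)
  where
  sheet : Fin 2 → Sign
  sheet zero = Sign.+
  sheet (suc zero) = Sign.-

IsIntegralFlowCover : ∀ {n m} (Σ : SignedGraph n m) → Orientation Σ → (CEdge m → ℤ) → Set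
IsIntegralFlowCover {n} Σ O f̃ = ∀ (x : CVertex n) → ∂̃ Σ O f̃ x ≡ + 0

-- projection π(f̃)(e) = f̃(ẽ) + f̃(ẽ*)
π : ∀ {m} → (CEdge m → ℤ) → Fin m → ℤ
π f̃ e = f̃ (e , Sign.+) + f̃ (e , Sign.-)

-- Put f̃ (e , +) = x e and f̃ (e , -) = f e - x e, so that π f̃ = f.  At a vertex y the difference
-- ∂̃ f̃ (y⁺) - ∂̃ f̃ (y⁻) is ∂ (π f̃) y = ∂ f y = 0, while the sum ∂̃ f̃ (y⁺) + ∂̃ f̃ (y⁻) is the
-- boundary, in the directed graph with an arc end₀ e → end₁ e for every edge, of
-- e ↦ ω(end₀ e, e) (2 x e - f e).  So f̃ is a flow as soon as the directed boundary of
-- a = ω(end₀, ·) x is half that of ω(end₀, ·) f.  Splitting ∂ f into its directed part and the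
-- contributions of negative edges shows that the directed boundary of ω(end₀, ·) f is 2 · (- excess),
-- and an integer vector which is twice a directed boundary is itself one: contracting a non-loop
-- arc u → v reduces this to a graph with one arc fewer.
module Submission where

open import Defs
open import Data.Nat using (ℕ; zero; suc)
open import Data.Fin using (Fin; zero; suc)
import Data.Fin as Fin
open import Data.Integer using (ℤ; +_; _+_; _*_; -_; _-_; 0ℤ; 1ℤ; -1ℤ)
open import Data.Integer.Properties
open import Data.Integer.Tactic.RingSolver using (solve-∀)
open import Data.Sign as Sign using (Sign)
import Data.Sign.Properties as SignP
open import Data.Product using (Σ-syntax; ∃-syntax; _×_; _,_)
open import Data.Vec.Functional using (_∷_)
open import Function using (_∘_)
open import Relation.Binary.PropositionalEquality
open import Relation.Binary.Definitions using (DecidableEquality)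
open import Relation.Nullary using (yes; no; contradiction)
open import Algebra.Properties.Semiring.Sum +-*-semiring
  using (sum; sum-cong-≗; ∑-distrib-+; *-distribˡ-sum; sum-replicate-zero)

open ≡-Reasoning

∑≡sum : ∀ {k} (f : Fin k → ℤ) → ∑ f ≡ sum f
∑≡sum {zero} f = refl
∑≡sum {suc k} f = cong (_+_ (f zero)) (∑≡sum (f ∘ suc))

∑-cong : ∀ {k} {f g : Fin k → ℤ} → (∀ i → f i ≡ g i) → ∑ f ≡ ∑ g
∑-cong {f = f} {g} f≗g = begin
  ∑ f   ≡⟨ ∑≡sum f ⟩
  sum f ≡⟨ sum-cong-≗ f≗g ⟩
  sum g ≡⟨ ∑≡sum g ⟨
  ∑ g   ∎

∑-+ : ∀ {k} (f g : Fin k → ℤ) → ∑ (λ i → f i + g i) ≡ ∑ f + ∑ g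
∑-+ f g = begin
  ∑ (λ i → f i + g i)   ≡⟨ ∑≡sum (λ i → f i + g i) ⟩
  sum (λ i → f i + g i) ≡⟨ ∑-distrib-+ f g ⟩
  sum f + sum g         ≡⟨ cong₂ _+_ (∑≡sum f) (∑≡sum g) ⟨
  ∑ f + ∑ g             ∎

∑-*ˡ : ∀ {k} (c : ℤ) (f : Fin k → ℤ) → ∑ (λ i → c * f i) ≡ c * ∑ f
∑-*ˡ c f = begin
  ∑ (λ i → c * f i)   ≡⟨ ∑≡sum (λ i → c * f i) ⟩
  sum (λ i → c * f i) ≡⟨ *-distribˡ-sum c f ⟨
  c * sum f           ≡⟨ cong (c *_) (∑≡sum f) ⟨
  c * ∑ f             ∎

∑-zero : ∀ k → ∑ {k} (λ _ → 0ℤ) ≡ 0ℤ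
∑-zero k = trans (∑≡sum {k} (λ _ → 0ℤ)) (sum-replicate-zero k)

∑∑-+ : ∀ {k l} (f g : Fin k → Fin l → ℤ) →
  ∑ (λ i → ∑ λ j → f i j + g i j) ≡ ∑ (λ i → ∑ (f i)) + ∑ (λ i → ∑ (g i))
∑∑-+ f g = trans (∑-cong λ i → ∑-+ (f i) (g i)) (∑-+ (λ i → ∑ (f i)) (λ i → ∑ (g i)))

∑∑∑-+ : ∀ {k l r} (f g : Fin k → Fin l → Fin r → ℤ) →
  ∑ (λ i → ∑ λ j → ∑ λ l → f i j l + g i j l)
    ≡ ∑ (λ i → ∑ λ j → ∑ (f i j)) + ∑ (λ i → ∑ λ j → ∑ (g i j))
∑∑∑-+ f g = trans (∑-cong λ i → ∑∑-+ (f i) (g i))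
                  (∑-+ (λ i → ∑ λ j → ∑ (f i j)) (λ i → ∑ λ j → ∑ (g i j)))

module Incidence {V : Set} (_≟_ : DecidableEquality V) where

  δ : V → V → ℤ
  δ x y with y ≟ x
  ... | yes _ = 1ℤ
  ... | no  _ = 0ℤ

  δ-refl : ∀ x → δ x x ≡ 1ℤ
  δ-refl x with x ≟ x
  ... | yes _   = refl
  ... | no  x≢x = contradiction refl x≢x

  δ-≢ : ∀ {x y} → y ≢ x → δ x y ≡ 0ℤ
  δ-≢ {x} {y} y≢x with y ≟ x
  ... | yes y≡x = contradiction y≡x y≢x
  ... | no  _   = refl

  endTerm-δ : ∀ x y s a → endTerm _≟_ x y s a ≡ δ x y * (signℤ s * a)
  endTerm-δ x y s a with y ≟ x
  ... | yes _ = sym (*-identityˡ (signℤ s * a))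
  ... | no  _ = sym (*-zeroˡ (signℤ s * a))

  arc : V → V → V → ℤ
  arc u v x = δ x u - δ x v

  incidence : ∀ {m} → (Fin m → V) → (Fin m → V) → (Fin m → ℤ) → V → ℤ
  incidence t h g x = ∑ λ e → arc (t e) (h e) x * g e

  IsBoundary : ∀ {m} → (Fin m → V) → (Fin m → V) → (V → ℤ) → Set
  IsBoundary t h b = ∃[ a ] ∀ x → incidence t h a x ≡ b x

  incidence-cong : ∀ {m} (t h : Fin m → V) {g g′} → (∀ e → g e ≡ g′ e) →
    ∀ x → incidence t h g x ≡ incidence t h g′ x
  incidence-cong t h g≗g′ x = ∑-cong λ e → cong (arc (t e) (h e) x *_) (g≗g′ e)

  incidence-linear : ∀ {m} (t h : Fin m → V) j p k q x →
    incidence t h (λ e → j * p e + k * q e) x ≡ j * incidence t h p x + k * incidence t h q x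
  incidence-linear t h j p k q x = begin
    ∑ (λ e → arc (t e) (h e) x * (j * p e + k * q e))
      ≡⟨ ∑-cong (λ e → distrib (arc (t e) (h e) x) j (p e) k (q e)) ⟩
    ∑ (λ e → j * (arc (t e) (h e) x * p e) + k * (arc (t e) (h e) x * q e))
      ≡⟨ ∑-+ (λ e → j * (arc (t e) (h e) x * p e)) (λ e → k * (arc (t e) (h e) x * q e)) ⟩
    ∑ (λ e → j * (arc (t e) (h e) x * p e)) + ∑ (λ e → k * (arc (t e) (h e) x * q e))
      ≡⟨ cong₂ _+_ (∑-*ˡ j (λ e → arc (t e) (h e) x * p e)) (∑-*ˡ k (λ e → arc (t e) (h e) x * q e)) ⟩
    j * incidence t h p x + k * incidence t h q x ∎
    where
    distrib : ∀ d j p k q → d * (j * p + k * q) ≡ j * (d * p) + k * (d * q)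
    distrib = solve-∀

  module Contraction (u v : V) (u≢v : u ≢ v) where

    merge : V → V
    merge z with z ≟ v
    ... | yes _ = u
    ... | no  _ = z

    -- Pushforward of vertex weights along merge: the weight at v moves to u.
    collapse : (V → ℤ) → V → ℤ
    collapse b y with y ≟ v
    ... | yes _ = 0ℤ
    ... | no  _ = b y + δ y u * b v

    δ-merge-v : ∀ z → δ v (merge z) ≡ 0ℤ
    δ-merge-v z with z ≟ v
    ... | yes _   = δ-≢ u≢v
    ... | no  z≢v = δ-≢ z≢v

    δ-merge : ∀ {y} → y ≢ v → ∀ z → δ y (merge z) ≡ δ y z + δ y u * δ v z
    δ-merge {y} y≢v z with z ≟ v
    -- The with has also evaluated the δ v z of the statement, to 1ℤ and 0ℤ respectively.
    ... | yes refl = begin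
      δ y u                 ≡⟨ *-identityʳ (δ y u) ⟨
      δ y u * 1ℤ            ≡⟨ +-identityˡ _ ⟨
      0ℤ + δ y u * 1ℤ       ≡⟨ cong (_+ δ y u * 1ℤ) (δ-≢ (y≢v ∘ sym)) ⟨
      δ y z + δ y u * 1ℤ    ∎
    ... | no  _ = begin
      δ y z                 ≡⟨ +-identityʳ (δ y z) ⟨
      δ y z + 0ℤ            ≡⟨ cong (_+_ (δ y z)) (*-zeroʳ (δ y u)) ⟨
      δ y z + δ y u * 0ℤ    ∎

    arc-at-v : arc u v v ≡ -1ℤ
    arc-at-v = cong₂ _-_ (δ-≢ u≢v) (δ-refl v)

    arc-off-v : ∀ {y} → y ≢ v → arc u v y ≡ δ y u
    arc-off-v {y} y≢v = trans (cong (_-_ (δ y u)) (δ-≢ (y≢v ∘ sym))) (+-identityʳ (δ y u))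

    arc-merge-v : ∀ a b → arc (merge a) (merge b) v ≡ 0ℤ
    arc-merge-v a b = cong₂ _-_ (δ-merge-v a) (δ-merge-v b)

    arc-merge : ∀ {y} → y ≢ v → ∀ a b → arc (merge a) (merge b) y ≡ arc a b y + δ y u * arc a b v
    arc-merge {y} y≢v a b = trans (cong₂ _-_ (δ-merge y≢v a) (δ-merge y≢v b))
                                  (regroup (δ y a) (δ y b) (δ y u) (δ v a) (δ v b))
      where
      regroup : ∀ p q c r s → (p + c * r) - (q + c * s) ≡ (p - q) + c * (r - s)
      regroup = solve-∀

    incidence-merge : ∀ {m} (t h : Fin m → V) g y →
      incidence (merge ∘ t) (merge ∘ h) g y ≡ collapse (incidence t h g) y
    incidence-merge {m} t h g y with y ≟ v
    ... | yes refl =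
      trans (∑-cong λ e → trans (cong (_* g e) (arc-merge-v (t e) (h e))) (*-zeroˡ (g e))) (∑-zero m)
    ... | no  y≢v = begin
      ∑ (λ e → arc (merge (t e)) (merge (h e)) y * g e)
        ≡⟨ ∑-cong (λ e → trans (cong (_* g e) (arc-merge y≢v (t e) (h e)))
                               (distrib (arc (t e) (h e) y) (δ y u) (arc (t e) (h e) v) (g e))) ⟩
      ∑ (λ e → arc (t e) (h e) y * g e + δ y u * (arc (t e) (h e) v * g e))
        ≡⟨ ∑-+ (λ e → arc (t e) (h e) y * g e) (λ e → δ y u * (arc (t e) (h e) v * g e)) ⟩
      incidence t h g y + ∑ (λ e → δ y u * (arc (t e) (h e) v * g e))
        ≡⟨ cong (_+_ (incidence t h g y)) (∑-*ˡ (δ y u) (λ e → arc (t e) (h e) v * g e)) ⟩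
      incidence t h g y + δ y u * incidence t h g v ∎
      where
      distrib : ∀ p c q r → (p + c * q) * r ≡ p * r + c * (q * r)
      distrib = solve-∀

    collapse-* : ∀ k b y → collapse (λ x → k * b x) y ≡ k * collapse b y
    collapse-* k b y with y ≟ v
    ... | yes _ = sym (*-zeroʳ k)
    ... | no  _ = factor k (b y) (δ y u) (b v)
      where
      factor : ∀ k p c q → k * p + c * (k * q) ≡ k * (p + c * q)
      factor = solve-∀

    collapse-shift : ∀ {b c} k → (∀ x → b x ≡ c x + arc u v x * k) →
      ∀ y → collapse b y ≡ collapse c y
    collapse-shift {b} {c} k b≡c+k·arc y with y ≟ v
    ... | yes _   = refl
    ... | no  y≢v = begin
      b y + δ y u * b v
        ≡⟨ cong₂ (λ p q → p + δ y u * q) (b≡c+k·arc y) (b≡c+k·arc v) ⟩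
      (c y + arc u v y * k) + δ y u * (c v + arc u v v * k)
        ≡⟨ cong₂ (λ p q → (c y + p * k) + δ y u * (c v + q * k)) (arc-off-v y≢v) arc-at-v ⟩
      (c y + δ y u * k) + δ y u * (c v + -1ℤ * k)
        ≡⟨ cancel (c y) (δ y u) (c v) k ⟩
      c y + δ y u * c v ∎
      where
      cancel : ∀ p d q k → (p + d * k) + d * (q + -1ℤ * k) ≡ p + d * q
      cancel = solve-∀

    collapse-injective : ∀ {b c} → (∀ y → collapse b y ≡ collapse c y) →
      ∀ x → b x ≡ c x + arc u v x * (c v - b v)
    collapse-injective {b} {c} same x with x ≟ v | same x
    ... | yes refl | _ = begin
      b x                            ≡⟨ solve-at-v (b x) (c x) ⟩
      c x + -1ℤ * (c x - b x)        ≡⟨ cong (λ p → c x + p * (c x - b x)) arc-at-v ⟨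
      c x + arc u x x * (c x - b x)  ∎
      where
      solve-at-v : ∀ p q → p ≡ q + -1ℤ * (q - p)
      solve-at-v = solve-∀
    ... | no x≢v | same-x = begin
      b x                                      ≡⟨ shuffle (b x) (δ x u) (b v) ⟩
      (b x + δ x u * b v) - δ x u * b v        ≡⟨ cong (_- δ x u * b v) same-x ⟩
      (c x + δ x u * c v) - δ x u * b v        ≡⟨ regroup (c x) (δ x u) (c v) (b v) ⟩
      c x + δ x u * (c v - b v)                ≡⟨ cong (λ p → c x + p * (c v - b v)) (arc-off-v x≢v) ⟨
      c x + arc u v x * (c v - b v)            ∎
      where
      shuffle : ∀ p d q → p ≡ (p + d * q) - d * q
      shuffle = solve-∀
      regroup : ∀ p d q r → (p + d * q) - d * r ≡ p + d * (q - r)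
      regroup = solve-∀

    contract : ∀ {m} (t h : Fin m → V) g₀ g b →
      (∀ x → arc u v x * g₀ + incidence t h g x ≡ + 2 * b x) →
      ∀ y → incidence (merge ∘ t) (merge ∘ h) g y ≡ + 2 * collapse b y
    contract t h g₀ g b ∂g≡2b y = begin
      incidence (merge ∘ t) (merge ∘ h) g y ≡⟨ incidence-merge t h g y ⟩
      collapse (incidence t h g) y          ≡⟨ collapse-shift (- g₀) shifted y ⟩
      collapse (λ x → + 2 * b x) y          ≡⟨ collapse-* (+ 2) b y ⟩
      + 2 * collapse b y                    ∎
      where
      move : ∀ a g₀ p → p ≡ (a * g₀ + p) + a * (- g₀)
      move = solve-∀
      shifted : ∀ x → incidence t h g x ≡ + 2 * b x + arc u v x * (- g₀)
      shifted x = trans (move (arc u v x) g₀ (incidence t h g x))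
                        (cong (_+ arc u v x * (- g₀)) (∂g≡2b x))

    uncontract : ∀ {m} (t h : Fin m → V) a b →
      (∀ y → incidence (merge ∘ t) (merge ∘ h) a y ≡ collapse b y) →
      ∀ x → arc u v x * (incidence t h a v - b v) + incidence t h a x ≡ b x
    uncontract t h a b ∂a≡b x =
      sym (trans (collapse-injective (λ y → trans (sym (∂a≡b y)) (incidence-merge t h a y)) x)
                 (+-comm (incidence t h a x) _))

  arc-loop : ∀ w x → arc w w x ≡ 0ℤ
  arc-loop w x = +-inverseʳ (δ x w)

  incidence-loop : ∀ {m} (t h : Fin (suc m) → V) g → t zero ≡ h zero →
    ∀ x → incidence t h g x ≡ incidence (t ∘ suc) (h ∘ suc) (g ∘ suc) x
  incidence-loop t h g loop x = begin
    arc (t zero) (h zero) x * g zero + rest ≡⟨ cong (λ d → d * g zero + rest) arc≡0 ⟩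
    0ℤ * g zero + rest                      ≡⟨ cong (_+ rest) (*-zeroˡ (g zero)) ⟩
    0ℤ + rest                               ≡⟨ +-identityˡ rest ⟩
    rest                                    ∎
    where
    rest = incidence (t ∘ suc) (h ∘ suc) (g ∘ suc) x
    arc≡0 : arc (t zero) (h zero) x ≡ 0ℤ
    arc≡0 = trans (cong (λ w → arc (t zero) w x) (sym loop)) (arc-loop (t zero) x)

  isBoundary-half : ∀ {m} (t h : Fin m → V) {b} →
    IsBoundary t h (λ x → + 2 * b x) → IsBoundary t h b
  isBoundary-half {zero} t h {b} (_ , ∂g≡2b) =
    (λ ()) , λ x → sym (*-cancelˡ-≡ (+ 2) (b x) 0ℤ (sym (∂g≡2b x)))
  isBoundary-half {suc m} t h {b} (g , ∂g≡2b) with t zero ≟ h zero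
  ... | yes loop =
    let a , ∂a≡b = isBoundary-half (t ∘ suc) (h ∘ suc)
                     (g ∘ suc , λ x → trans (sym (incidence-loop t h g loop x)) (∂g≡2b x))
    in  0ℤ ∷ a , λ x → trans (incidence-loop t h (0ℤ ∷ a) loop x) (∂a≡b x)
  ... | no u≢v =
    let open Contraction (t zero) (h zero) u≢v
        t′ = t ∘ suc
        h′ = h ∘ suc
        a , ∂a≡b = isBoundary-half (merge ∘ t′) (merge ∘ h′)
                     (g ∘ suc , contract t′ h′ (g zero) (g ∘ suc) b ∂g≡2b)
    in  (incidence t′ h′ a (h zero) - b (h zero)) ∷ a , uncontract t′ h′ a b ∂a≡b

open Incidence SignP._≟_ using () renaming (δ to δˢ)

-- (signℤ a + signℤ b) / 2; for the two ends of an edge it vanishes unless the edge is negative.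
signMean : Sign → Sign → ℤ
signMean Sign.+ Sign.+ = 1ℤ
signMean Sign.- Sign.- = -1ℤ
signMean Sign.+ Sign.- = 0ℤ
signMean Sign.- Sign.+ = 0ℤ

-- Sums over the two ends (or sheets) appear unfolded, as f 0 + (f 1 + 0).
edge-boundary : ∀ ω₀ ω₁ d₀ d₁ F →
  d₀ * (signℤ ω₀ * F) + (d₁ * (signℤ ω₁ * F) + 0ℤ)
    ≡ (d₀ - d₁) * (signℤ ω₀ * F) + + 2 * (d₁ * (signMean ω₀ ω₁ * F))
edge-boundary Sign.+ Sign.+ = solve-∀
edge-boundary Sign.+ Sign.- = solve-∀
edge-boundary Sign.- Sign.+ = solve-∀
edge-boundary Sign.- Sign.- = solve-∀

sheet-difference : ∀ L w d v →
  δˢ Sign.+ L * (d * (signℤ (L Sign.* w) * v))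
    ≡ δˢ Sign.- L * (d * (signℤ (L Sign.* w) * v)) + d * (signℤ w * v)
sheet-difference Sign.+ Sign.+ = solve-∀
sheet-difference Sign.+ Sign.- = solve-∀
sheet-difference Sign.- Sign.+ = solve-∀
sheet-difference Sign.- Sign.- = solve-∀

sheet-sum : ∀ L X → δˢ Sign.+ L * X + δˢ Sign.- L * X ≡ X
sheet-sum Sign.+ = solve-∀
sheet-sum Sign.- = solve-∀

lifted-edge-sum : ∀ σ ω₀ ω₁ → σ ≡ Sign.opposite (ω₀ Sign.* ω₁) → ∀ d₀ d₁ p q →
  (d₀ * (signℤ ω₀ * p) + (d₁ * (signℤ (σ Sign.* ω₁) * p) + 0ℤ))
    + ((d₀ * (signℤ (Sign.opposite ω₀) * q) + (d₁ * (signℤ (Sign.opposite σ Sign.* ω₁) * q) + 0ℤ)) + 0ℤ)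
    ≡ (d₀ - d₁) * (signℤ ω₀ * (p - q))
lifted-edge-sum _ Sign.+ Sign.+ refl = solve-∀
lifted-edge-sum _ Sign.+ Sign.- refl = solve-∀
lifted-edge-sum _ Sign.- Sign.+ refl = solve-∀
lifted-edge-sum _ Sign.- Sign.- refl = solve-∀

lift-difference : ∀ w a F →
  signℤ w * (signℤ w * a - (F - signℤ w * a)) ≡ + 2 * a + -1ℤ * (signℤ w * F)
lift-difference Sign.+ = solve-∀
lift-difference Sign.- = solve-∀

liftFlow : ∀ {m} → (Fin m → ℤ) → (Fin m → ℤ) → CEdge m → ℤ
liftFlow f x (e , Sign.+) = x e
liftFlow f x (e , Sign.-) = f e - x e

π-liftFlow : ∀ {m} (f x : Fin m → ℤ) e → π (liftFlow f x) e ≡ f e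
π-liftFlow f x e = telescope (x e) (f e)
  where
  telescope : ∀ p q → p + (q - p) ≡ q
  telescope = solve-∀

-- The enumeration (e , +) = ẽ, (e , -) = ẽ* of the lifts of e used inside ∂̃.
sheet : Fin 2 → Sign
sheet zero       = Sign.+
sheet (suc zero) = Sign.-

module _ {n : ℕ} where
  open Incidence (Fin._≟_ {n})

  endTerm-cover : ∀ (y z : Fin n) β γ s v →
    endTerm _≟V_ (y , β) (z , γ) s v ≡ δˢ β γ * (δ y z * (signℤ s * v))
  endTerm-cover y z β γ s v with z Fin.≟ y
  ... | no _ = sym (trans (cong (δˢ β γ *_) (*-zeroˡ (signℤ s * v))) (*-zeroʳ (δˢ β γ)))
  ... | yes refl with γ SignP.≟ β
  ...   | yes _ = sym (trans (*-identityˡ (1ℤ * (signℤ s * v))) (*-identityˡ (signℤ s * v)))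
  ...   | no  _ = sym (*-zeroˡ (1ℤ * (signℤ s * v)))

  endTerm-+ : ∀ (y z : Fin n) s p q →
    endTerm Fin._≟_ y z s p + endTerm Fin._≟_ y z s q ≡ endTerm Fin._≟_ y z s (p + q)
  endTerm-+ y z s p q with z Fin.≟ y
  ... | yes _ = sym (*-distribˡ-+ (signℤ s) p q)
  ... | no  _ = refl

  sheet-end-difference : ∀ (y z : Fin n) L w v →
    endTerm _≟V_ (y , Sign.+) (z , L) (L Sign.* w) v
      ≡ endTerm _≟V_ (y , Sign.-) (z , L) (L Sign.* w) v + endTerm Fin._≟_ y z w v
  sheet-end-difference y z L w v = begin
    endTerm _≟V_ (y , Sign.+) (z , L) (L Sign.* w) v
      ≡⟨ endTerm-cover y z Sign.+ L (L Sign.* w) v ⟩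
    δˢ Sign.+ L * (δ y z * (signℤ (L Sign.* w) * v))
      ≡⟨ sheet-difference L w (δ y z) v ⟩
    δˢ Sign.- L * (δ y z * (signℤ (L Sign.* w) * v)) + δ y z * (signℤ w * v)
      ≡⟨ cong₂ _+_ (endTerm-cover y z Sign.- L (L Sign.* w) v) (endTerm-δ y z w v) ⟨
    endTerm _≟V_ (y , Sign.-) (z , L) (L Sign.* w) v + endTerm Fin._≟_ y z w v ∎

  sheet-end-sum : ∀ (y z : Fin n) L s v →
    endTerm _≟V_ (y , Sign.+) (z , L) s v + endTerm _≟V_ (y , Sign.-) (z , L) s v ≡ δ y z * (signℤ s * v)
  sheet-end-sum y z L s v =
    trans (cong₂ _+_ (endTerm-cover y z Sign.+ L s v) (endTerm-cover y z Sign.- L s v))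
          (sheet-sum L (δ y z * (signℤ s * v)))

module _ {n m : ℕ} (Σ : SignedGraph n m) (O : Orientation Σ) where
  open Incidence (Fin._≟_ {n})

  end₀ end₁ : Fin m → Fin n
  end₀ e = endpoint Σ e zero
  end₁ e = endpoint Σ e (suc zero)

  ω₀ ω₁ : Fin m → Sign
  ω₀ e = ω O e zero
  ω₁ e = ω O e (suc zero)

  liftedEnd : Sign → (CEdge m → ℤ) → Fin n → Fin m → Fin 2 → End → ℤ
  liftedEnd β g y e a i =
    endTerm _≟V_ (y , β) (liftEndpoint Σ (e , sheet a) i) (liftω Σ O (e , sheet a) i) (g (e , sheet a))

  cover-difference : ∀ g y → ∂̃ Σ O g (y , Sign.+) ≡ ∂̃ Σ O g (y , Sign.-) + ∂ O (π g) y
  cover-difference g y = begin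
    ∂̃ Σ O g (y , Sign.+)
      ≡⟨ ∑-cong (λ e → ∑-cong λ a → ∑-cong λ i →
           sheet-end-difference y (endpoint Σ e i) (liftSheet Σ (e , sheet a) i) (ω O e i) (g (e , sheet a))) ⟩
    ∑ (λ e → ∑ λ a → ∑ λ i → liftedEnd Sign.- g y e a i + base e a i)
      ≡⟨ ∑∑∑-+ (liftedEnd Sign.- g y) base ⟩
    ∂̃ Σ O g (y , Sign.-) + ∑ (λ e → ∑ λ a → ∑ (base e a))
      ≡⟨ cong (_+_ (∂̃ Σ O g (y , Sign.-))) (∑-cong project) ⟩
    ∂̃ Σ O g (y , Sign.-) + ∂ O (π g) y ∎
    where
    base : Fin m → Fin 2 → End → ℤ
    base e a i = endTerm Fin._≟_ y (endpoint Σ e i) (ω O e i) (g (e , sheet a))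
    swap : ∀ p q r s → (p + (q + 0ℤ)) + ((r + (s + 0ℤ)) + 0ℤ) ≡ (p + r) + ((q + s) + 0ℤ)
    swap = solve-∀
    project : ∀ e → ∑ (λ a → ∑ (base e a)) ≡ ∑ λ i → endTerm Fin._≟_ y (endpoint Σ e i) (ω O e i) (π g e)
    project e = trans (swap (base e zero zero) (base e zero (suc zero)) (base e (suc zero) zero) (base e (suc zero) (suc zero)))
                      (cong₂ (λ p q → p + (q + 0ℤ))
                             (endTerm-+ y (endpoint Σ e zero) (ω O e zero) (g (e , Sign.+)) (g (e , Sign.-)))
                             (endTerm-+ y (endpoint Σ e (suc zero)) (ω O e (suc zero)) (g (e , Sign.+)) (g (e , Sign.-))))

  cover-sum : ∀ g y → ∂̃ Σ O g (y , Sign.+) + ∂̃ Σ O g (y , Sign.-)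
    ≡ incidence end₀ end₁ (λ e → signℤ (ω₀ e) * (g (e , Sign.+) - g (e , Sign.-))) y
  cover-sum g y = begin
    ∂̃ Σ O g (y , Sign.+) + ∂̃ Σ O g (y , Sign.-)
      ≡⟨ ∑∑∑-+ (liftedEnd Sign.+ g y) (liftedEnd Sign.- g y) ⟨
    ∑ (λ e → ∑ λ a → ∑ λ i → liftedEnd Sign.+ g y e a i + liftedEnd Sign.- g y e a i)
      ≡⟨ ∑-cong (λ e → ∑-cong λ a → ∑-cong λ i →
           sheet-end-sum y (endpoint Σ e i) (liftSheet Σ (e , sheet a) i) (liftω Σ O (e , sheet a) i) (g (e , sheet a))) ⟩
    ∑ (λ e → ∑ λ a → ∑ λ i → δ y (endpoint Σ e i) * (signℤ (liftω Σ O (e , sheet a) i) * g (e , sheet a)))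
      ≡⟨ ∑-cong (λ e → lifted-edge-sum (sign Σ e) (ω₀ e) (ω₁ e) (compat O e)
                         (δ y (end₀ e)) (δ y (end₁ e)) (g (e , Sign.+)) (g (e , Sign.-))) ⟩
    incidence end₀ end₁ (λ e → signℤ (ω₀ e) * (g (e , Sign.+) - g (e , Sign.-))) y ∎

  excess : (Fin m → ℤ) → Fin n → ℤ
  excess f y = ∑ λ e → δ y (end₁ e) * (signMean (ω₀ e) (ω₁ e) * f e)

  ∂-decompose : ∀ f y → ∂ O f y ≡ incidence end₀ end₁ (λ e → signℤ (ω₀ e) * f e) y + + 2 * excess f y
  ∂-decompose f y = begin
    ∂ O f y
      ≡⟨ ∑-cong (λ e → trans (cong₂ (λ p q → p + (q + 0ℤ)) (endTerm-δ y (end₀ e) (ω₀ e) (f e))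
                                                          (endTerm-δ y (end₁ e) (ω₁ e) (f e)))
                             (edge-boundary (ω₀ e) (ω₁ e) (δ y (end₀ e)) (δ y (end₁ e)) (f e))) ⟩
    ∑ (λ e → arc (end₀ e) (end₁ e) y * (signℤ (ω₀ e) * f e) + + 2 * excessTerm e)
      ≡⟨ ∑-+ (λ e → arc (end₀ e) (end₁ e) y * (signℤ (ω₀ e) * f e)) (λ e → + 2 * excessTerm e) ⟩
    incidence end₀ end₁ (λ e → signℤ (ω₀ e) * f e) y + ∑ (λ e → + 2 * excessTerm e)
      ≡⟨ cong (_+_ (incidence end₀ end₁ (λ e → signℤ (ω₀ e) * f e) y)) (∑-*ˡ (+ 2) excessTerm) ⟩
    incidence end₀ end₁ (λ e → signℤ (ω₀ e) * f e) y + + 2 * excess f y ∎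
    where
    excessTerm : Fin m → ℤ
    excessTerm e = δ y (end₁ e) * (signMean (ω₀ e) (ω₁ e) * f e)

  ∂-cong : ∀ {f f′} → (∀ e → f e ≡ f′ e) → ∀ y → ∂ O f y ≡ ∂ O f′ y
  ∂-cong f≗f′ y = ∑-cong λ e → ∑-cong λ i → cong (endTerm Fin._≟_ y (endpoint Σ e i) (ω O e i)) (f≗f′ e)

  flow-incidence : ∀ {f} → IsIntegralFlow O f →
    ∀ y → incidence end₀ end₁ (λ e → signℤ (ω₀ e) * f e) y ≡ + 2 * - excess f y
  flow-incidence {f} isFlow y = begin
    I                                           ≡⟨ isolate I (excess f y) ⟩
    (I + + 2 * excess f y) + + 2 * - excess f y ≡⟨ cong (_+ + 2 * - excess f y) ∂f≡0 ⟩
    0ℤ + + 2 * - excess f y                     ≡⟨ +-identityˡ (+ 2 * - excess f y) ⟩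
    + 2 * - excess f y                          ∎
    where
    I = incidence end₀ end₁ (λ e → signℤ (ω₀ e) * f e) y
    ∂f≡0 : I + + 2 * excess f y ≡ 0ℤ
    ∂f≡0 = trans (sym (∂-decompose f y)) (isFlow y)
    isolate : ∀ i c → i ≡ (i + + 2 * c) + + 2 * - c
    isolate = solve-∀

  cover-flow : ∀ g → (∀ y → ∂̃ Σ O g (y , Sign.+) + ∂̃ Σ O g (y , Sign.-) ≡ 0ℤ) →
    (∀ y → ∂̃ Σ O g (y , Sign.+) ≡ ∂̃ Σ O g (y , Sign.-)) → IsIntegralFlowCover Σ O g
  cover-flow g sum≡0 +≡- = flow
    where
    double : ∀ p → + 2 * p ≡ p + p
    double = solve-∀
    minus-sheet : ∀ y → ∂̃ Σ O g (y , Sign.-) ≡ 0ℤ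
    minus-sheet y = *-cancelˡ-≡ (+ 2) (∂̃ Σ O g (y , Sign.-)) 0ℤ
      (trans (double (∂̃ Σ O g (y , Sign.-)))
             (trans (cong (_+ ∂̃ Σ O g (y , Sign.-)) (sym (+≡- y))) (sum≡0 y)))
    flow : IsIntegralFlowCover Σ O g
    flow (y , Sign.+) = trans (+≡- y) (minus-sheet y)
    flow (y , Sign.-) = minus-sheet y

  sheets-agree : ∀ {f} → IsIntegralFlow O f → ∀ x y →
    ∂̃ Σ O (liftFlow f x) (y , Sign.+) ≡ ∂̃ Σ O (liftFlow f x) (y , Sign.-)
  sheets-agree {f} isFlow x y = begin
    ∂̃ Σ O f̃ (y , Sign.+)                ≡⟨ cover-difference f̃ y ⟩
    ∂̃ Σ O f̃ (y , Sign.-) + ∂ O (π f̃) y ≡⟨ cong (_+_ (∂̃ Σ O f̃ (y , Sign.-))) ∂πf̃≡0 ⟩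
    ∂̃ Σ O f̃ (y , Sign.-) + 0ℤ          ≡⟨ +-identityʳ (∂̃ Σ O f̃ (y , Sign.-)) ⟩
    ∂̃ Σ O f̃ (y , Sign.-)               ∎
    where
    f̃ = liftFlow f x
    ∂πf̃≡0 : ∂ O (π f̃) y ≡ 0ℤ
    ∂πf̃≡0 = trans (∂-cong (π-liftFlow f x) y) (isFlow y)

  sheets-cancel : ∀ {f a} → IsIntegralFlow O f → (∀ y → incidence end₀ end₁ a y ≡ - excess f y) →
    ∀ y → ∂̃ Σ O (liftFlow f (λ e → signℤ (ω₀ e) * a e)) (y , Sign.+)
          + ∂̃ Σ O (liftFlow f (λ e → signℤ (ω₀ e) * a e)) (y , Sign.-) ≡ 0ℤ
  sheets-cancel {f} {a} isFlow ∂a≡-excess y = begin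
    ∂̃ Σ O f̃ (y , Sign.+) + ∂̃ Σ O f̃ (y , Sign.-)
      ≡⟨ cover-sum f̃ y ⟩
    incidence end₀ end₁ (λ e → signℤ (ω₀ e) * (f̃ (e , Sign.+) - f̃ (e , Sign.-))) y
      ≡⟨ incidence-cong end₀ end₁ (λ e → lift-difference (ω₀ e) (a e) (f e)) y ⟩
    incidence end₀ end₁ (λ e → + 2 * a e + -1ℤ * (signℤ (ω₀ e) * f e)) y
      ≡⟨ incidence-linear end₀ end₁ (+ 2) a -1ℤ (λ e → signℤ (ω₀ e) * f e) y ⟩
    + 2 * incidence end₀ end₁ a y + -1ℤ * incidence end₀ end₁ (λ e → signℤ (ω₀ e) * f e) y
      ≡⟨ cong₂ (λ p q → + 2 * p + -1ℤ * q) (∂a≡-excess y) (flow-incidence isFlow y) ⟩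
    + 2 * - excess f y + -1ℤ * (+ 2 * - excess f y)
      ≡⟨ cancel (- excess f y) ⟩
    0ℤ ∎
    where
    f̃ = liftFlow f (λ e → signℤ (ω₀ e) * a e)
    cancel : ∀ c → + 2 * c + -1ℤ * (+ 2 * c) ≡ 0ℤ
    cancel = solve-∀

lemma4p4 : ∀ {n m : ℕ} (Σ : SignedGraph n m) (O : Orientation Σ) (f : Fin m → ℤ) →
    IsIntegralFlow O f →
    Σ[ f̃ ∈ (CEdge m → ℤ) ] (IsIntegralFlowCover Σ O f̃ × (∀ e → π f̃ e ≡ f e))
lemma4p4 {n} Σ O f isFlow =
  let a , ∂a≡-excess = isBoundary-half (end₀ Σ O) (end₁ Σ O) (_ , flow-incidence Σ O isFlow)
      x e = signℤ (ω₀ Σ O e) * a e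
  in  liftFlow f x
    , cover-flow Σ O (liftFlow f x) (sheets-cancel Σ O isFlow ∂a≡-excess) (sheets-agree Σ O isFlow x)
    , π-liftFlow f x
  where open Incidence (Fin._≟_ {n}) using (isBoundary-half)
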